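{- Let $4 \le p \le q$ and let $D$ be a strong orientation of $K(3,p,q)$ with diameter two, with parts $V_1=\{x_1,x_2,x_3\}$, $V_2$ ($|V_2|=p$), $V_3$ ($|V_3|=q$). If exactly three of the eight sets $V_2^A$ ($A \subseteq \{1,2,3\}$) are nonempty, then $$q \le 1 + \binom{p-3}{\lfloor \frac{p-3}{2} \rfloor} + \binom{p-1}{\lfloor \frac{p-1}{2} \rfloor} + \binom{p}{\lfloor \frac{p}{2} \rfloor}.$$
   Context: $K(3,p,q)$ is the complete tripartite graph with parts $V_1=\{x_1,x_2,x_3\}$, $V_2$ of size $p$, $V_3$ of size $q$. A strong orientation is an orientation of all edges making the digraph strongly connected; its diameter is the maximum directed distance between ordered pairs of vertices. Write $u\to v$ if the edge $uv$ is oriented from $u$ to $v$. For $A \subseteq [3]=\{1,2,3\}$, let $N_D^A$ be the set of vertices $w$ such that $x_i \to w$ for all $i \in A$ and $w \to x_j$ for all $j \in [3]\setminus A$, and $V_2^A = V_2 \cap N_D^A$. The eight sets $V_2^A$ partition $V_2$. -}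

module Defs where

open import Data.Nat using (ℕ)
open import Data.Fin using (Fin)
open import Data.Bool using (Bool; true; false; T; not)
open import Data.Vec using (Vec; lookup)
open import Data.Product using (Σ; ∃; _×_)
open import Data.Sum using (_⊎_)
open import Data.Empty using (⊥)
open import Relation.Nullary using (¬_)
open import Relation.Binary.PropositionalEquality using (_≡_; _≢_)

data Vertex (p q : ℕ) : Set where
  x : Fin 3 → Vertex p q
  a : Fin p → Vertex p q
  b : Fin q → Vertex p q

-- An orientation of K(3,p,q): every edge (between distinct parts) gets exactly
-- one direction.  o12 i v = true  means  x i → a v  (false: a v → x i);
-- o13 i w = true means x i → b w;  o23 v w = true means a v → b w.
record Orientation (p q : ℕ) : Set where
  field
    o12 : Fin 3 → Fin p → Bool
    o13 : Fin 3 → Fin q → Bool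
    o23 : Fin p → Fin q → Bool

Arc : ∀ {p q} → Orientation p q → Vertex p q → Vertex p q → Set
Arc D (x i) (a v) = T (Orientation.o12 D i v)
Arc D (a v) (x i) = T (not (Orientation.o12 D i v))
Arc D (x i) (b w) = T (Orientation.o13 D i w)
Arc D (b w) (x i) = T (not (Orientation.o13 D i w))
Arc D (a v) (b w) = T (Orientation.o23 D v w)
Arc D (b w) (a v) = T (not (Orientation.o23 D v w))
Arc D _ _ = ⊥

Dist≤2 : ∀ {p q} → Orientation p q → Vertex p q → Vertex p q → Set
Dist≤2 D u v = u ≡ v ⊎ Arc D u v ⊎ Σ (Vertex _ _) (λ w → Arc D u w × Arc D w v)

-- D has diameter two: every ordered pair is at directed distance ≤ 2
-- (this also makes D strongly connected, i.e. a strong orientation),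
-- and some ordered pair is at distance exactly 2 (not ≤ 1).
DiameterTwo : ∀ {p q} → Orientation p q → Set
DiameterTwo D =
  (∀ u v → Dist≤2 D u v) ×
  Σ (Vertex _ _) (λ u → Σ (Vertex _ _) (λ v → ¬ (u ≡ v ⊎ Arc D u v)))

Subset3 : Set
Subset3 = Vec Bool 3

InN : ∀ {p q} → Orientation p q → Subset3 → Vertex p q → Set
InN D A w = ∀ (i : Fin 3) →
  (lookup A i ≡ true → Arc D (x i) w) × (lookup A i ≡ false → Arc D w (x i))

V2NonEmpty : ∀ {p q} → Orientation p q → Subset3 → Set
V2NonEmpty D A = Σ (Fin _) (λ v → InN D A (a v))

ExactlyThreeNonEmpty : ∀ {p q} → Orientation p q → Set
ExactlyThreeNonEmpty D =
  Σ Subset3 (λ A → Σ Subset3 (λ B → Σ Subset3 (λ C →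
    (A ≢ B × A ≢ C × B ≢ C) ×
    (V2NonEmpty D A × V2NonEmpty D B × V2NonEmpty D C) ×
    (∀ E → V2NonEmpty D E → E ≡ A ⊎ E ≡ B ⊎ E ≡ C))))

{-# OPTIONS --safe #-}

-- Give every vertex of V₂ or V₃ the type {i ∣ x i → vertex}.  Diameter two forces an arc
-- v → w to go back through some x i lying in the type of v but not in that of w (dually
-- for w → v).  So V₃ has no type of V₂, all arcs between comparable types are determined,
-- and V₃-vertices of one type T have pairwise incomparable neighbourhoods in V₂: by
-- Sperner there are at most C(m, ⌊m/2⌋) of them, where m counts the vertices of V₂ whose
-- arcs to type T are not determined.  The arcs of a vertex v of V₂ are determined as well
-- if v alone lies in its type and, for some i, every other type in V₂ agrees with T at i:
-- then v is the only possible midpoint between x i and the vertices of type T.  In each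
-- configuration of three types in V₂ (each with one or with several vertices) the
-- resulting bounds sum to at most the claimed one, by inequalities between central
-- binomial coefficients.
module Submission where

open import Defs
open import Algebra.Properties.CommutativeSemigroup using (interchange)
open import Data.Bool using (Bool; true; false; T; not; if_then_else_)
import Data.Bool as Bool
import Data.Bool.Properties as Boolₚ
open import Data.Fin using (Fin; zero; suc)
import Data.Fin.Properties as Finₚ
open import Data.List using (List; []; _∷_; length; map; filter; allFin; _++_; lookup)
open import Data.List.Properties using (length-++; length-tabulate; map-++; map-∘)
open import Data.List.Membership.Propositional using (_∈_)
open import Data.List.Membership.Propositional.Properties
  using (∈-filter⁺; ∈-filter⁻; ∈-lookup; ∈-allFin; ∈-++⁺ˡ; ∈-++⁺ʳ; ∈-++⁻; ∈-map⁺)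
open import Data.List.Relation.Binary.Permutation.Propositional using (↭-sym)
open import Data.List.Relation.Binary.Disjoint.Propositional using (Disjoint)
import Data.List.Relation.Binary.Permutation.Propositional.Properties as Permutation
open import Data.List.Relation.Binary.Pointwise as Pointwise using (Pointwise; []; _∷_)
open import Data.List.Relation.Unary.All as All using (All; []; _∷_)
open import Data.List.Relation.Unary.Any as Any using (Any; here; there)
import Data.List.Relation.Unary.Any.Properties as Anyₚ
open import Data.List.Relation.Unary.AllPairs using ([]; _∷_)
open import Data.List.Relation.Unary.Unique.Propositional using (Unique)
import Data.List.Relation.Unary.Unique.Propositional.Properties as Unique
open import Data.Nat using (ℕ; zero; suc; _≤_; _<_; _+_; _∸_; ⌊_/2⌋; z≤n; s≤s; s≤s⁻¹; _<?_; _≤?_; _≤′_; ≤′-refl; ≤′-step)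
open import Data.Nat.Combinatorics using (_C_; nCk+nC[k+1]≡[n+1]C[k+1])
open import Data.Nat.ListAction using (sum)
open import Data.Nat.ListAction.Properties using (sum-↭)
open import Data.Nat.Properties
open import Data.Nat.Tactic.RingSolver using (solve-∀)
open import Data.List.Sort.InsertionSort ≤-decTotalOrder using (sort; insertionSort)
open import Data.List.Sort.Base ≤-totalOrder using (SortingAlgorithm)
open SortingAlgorithm insertionSort using (sort-↭)
open import Data.Product using (∃; _×_; _,_; proj₁; proj₂)
open import Data.Sum using (_⊎_; inj₁; inj₂; [_,_]′; map₁)
open import Data.Vec as Vec using (Vec; []; _∷_)
import Data.Vec.Properties as Vecₚ
open import Function using (_∘_; id)
open import Relation.Binary.Definitions using (DecidableEquality)
open import Relation.Binary.PropositionalEquality using (_≡_; _≢_; refl; sym; trans; cong; cong₂; subst)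
open import Relation.Nullary using (¬_; Dec; yes; no; does; contradiction)
open import Relation.Nullary.Decidable using (_×-dec_; _⊎-dec_; _→-dec_; ¬?; toWitness; dec-true; map′; dec-false)
open import Relation.Unary using (Decidable)
open import Relation.Unary.Properties using (∁?)

-- Non-negative walks and central binomial coefficients.

-- The number of ±1 walks of length n from height h that stay non-negative; it
-- is also the largest size of an antichain in {0 < … < h} × 2ⁿ.
walks : ℕ → ℕ → ℕ
walks zero    h       = 1
walks (suc n) zero    = walks n 1
walks (suc n) (suc h) = walks n (suc (suc h)) + walks n h

ballots : ℕ → ℕ
ballots n = walks n 0

-- Σ_{j ≤ h} C(n, t − j), where binomials with a negative lower index are 0.
binomialRun : ℕ → ℕ → ℕ → ℕ
binomialRun n t       zero    = n C t
binomialRun n zero    (suc h) = 1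
binomialRun n (suc t) (suc h) = n C suc t + binomialRun n t h

binomialRun-zero : ∀ n h → binomialRun n 0 h ≡ 1
binomialRun-zero n zero    = refl
binomialRun-zero n (suc h) = refl

binomialRun-pascal : ∀ n t h →
  binomialRun (suc n) (suc t) h ≡ binomialRun n (suc t) h + binomialRun n t h
binomialRun-pascal n t zero = trans (sym (nCk+nC[k+1]≡[n+1]C[k+1] n t)) (+-comm (n C t) (n C suc t))
binomialRun-pascal n zero (suc h) rewrite binomialRun-zero n h | binomialRun-zero (suc n) h =
  cong (_+ 1) (trans (sym (nCk+nC[k+1]≡[n+1]C[k+1] n 0)) (+-comm 1 (n C 1)))
binomialRun-pascal n (suc t) (suc h)
  rewrite binomialRun-pascal n t h | sym (nCk+nC[k+1]≡[n+1]C[k+1] n (suc t)) =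
  trans (cong (_+ (binomialRun n (suc t) h + binomialRun n t h)) (+-comm (n C suc t) (n C suc (suc t))))
        (interchange +-commutativeSemigroup (n C suc (suc t)) (n C suc t) (binomialRun n (suc t) h) (binomialRun n t h))

-- By induction: in the recurrence at height h + 1 the window of h + 3 terms gives its top term to
-- the window of h + 1 terms, and Pascal's rule adds the resulting two windows of h + 2 terms.
walks≡binomialRun : ∀ n h → walks n h ≡ binomialRun n ⌊ n + h /2⌋ h
-- The window reaches down to index 0, where `0 C 0` is its only nonzero term.
walks≡binomialRun zero h = sym (run≡1 (⌊n/2⌋≤n h))
  where
  run≡1 : ∀ {t h} → t ≤ h → binomialRun 0 t h ≡ 1
  run≡1 {h = h} z≤n = binomialRun-zero 0 h
  run≡1 (s≤s t≤h)   = run≡1 t≤h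
walks≡binomialRun (suc n) zero = trans (walks≡binomialRun n 1) (run-one n (cong ⌊_/2⌋ (trans (+-comm n 1) (cong suc (sym (+-identityʳ n))))))
  where
  run-one : ∀ n {t t′} → t ≡ t′ → binomialRun n t 1 ≡ suc n C t′
  run-one n {zero}  refl = refl
  run-one n {suc t} refl = sym (binomialRun-pascal n t 0)
walks≡binomialRun (suc n) (suc h)
  rewrite walks≡binomialRun n (suc (suc h)) | walks≡binomialRun n h
        | +-suc n (suc h) | +-suc n h =
  trans (trans (+-assoc (n C suc t) (binomialRun n t (suc h)) (binomialRun n t h))
               (trans (cong (n C suc t +_) (+-comm (binomialRun n t (suc h)) (binomialRun n t h)))
                      (sym (+-assoc (n C suc t) (binomialRun n t h) (binomialRun n t (suc h))))))
        (sym (binomialRun-pascal n t (suc h)))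
  where t = ⌊ n + h /2⌋

ballots≡middle-binomial : ∀ n → ballots n ≡ n C ⌊ n /2⌋
ballots≡middle-binomial n = trans (walks≡binomialRun n 0) (cong (λ m → n C ⌊ m /2⌋) (+-identityʳ n))

walks-monoʳ : ∀ n h → walks n h ≤ walks n (suc h)
walks-monoʳ zero    h       = ≤-refl
walks-monoʳ (suc n) zero    = ≤-trans (walks-monoʳ n 1) (m≤m+n _ _)
walks-monoʳ (suc n) (suc h) = +-mono-≤ (walks-monoʳ n (suc (suc h))) (walks-monoʳ n h)

ballots-monoˢ : ∀ n → ballots n ≤ ballots (suc n)
ballots-monoˢ n = walks-monoʳ n 0

1≤ballots : ∀ n → 1 ≤ ballots n
1≤ballots zero    = ≤-refl
1≤ballots (suc n) = ≤-trans (1≤ballots n) (ballots-monoˢ n)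

-- A walk extends by one step in at most two ways.
walks-double : ∀ n h → walks (suc n) h ≤ walks n h + walks n h
walks-double zero    zero    = s≤s z≤n
walks-double zero    (suc h) = ≤-refl
walks-double (suc n) zero    = walks-double n 1
walks-double (suc n) (suc h) = ≤-trans
  (+-mono-≤ (walks-double n (suc (suc h))) (walks-double n h))
  (≤-reflexive (interchange +-commutativeSemigroup (walks n (suc (suc h))) _ (walks n h) _))

ballots-superadditive : ∀ n → ballots n + ballots (suc n) ≤ ballots (2 + n)
ballots-superadditive n =
  ≤-trans (≤-reflexive (+-comm (ballots n) _)) (+-monoˡ-≤ (walks n 0) (walks-monoʳ n 1))

-- One copy of `ballots (suc n)`, that is `walks n 1`, is at most twice `walks n 0`, the other at
-- most `walks n 2`; and `ballots (2 + n)` unfolds to `walks n 2 + walks n 0`.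
ballots-convex : ∀ n → ballots (suc n) + ballots (suc n) ≤ ballots n + ballots (2 + n)
ballots-convex n = begin
  walks n 1 + walks n 1                     ≤⟨ +-mono-≤ (walks-double n 0) (walks-monoʳ n 1) ⟩
  (walks n 0 + walks n 0) + walks n 2       ≡⟨ +-assoc (walks n 0) _ _ ⟩
  walks n 0 + (walks n 0 + walks n 2)       ≡⟨ cong (walks n 0 +_) (+-comm (walks n 0) _) ⟩
  walks n 0 + (walks n 2 + walks n 0)       ∎
  where open ≤-Reasoning

-- Counting in lists and the antichain bound.

length-filter-∁ : ∀ {A : Set} {P : A → Set} (P? : Decidable P) xs →
  length xs ≡ length (filter P? xs) + length (filter (∁? P?) xs)
length-filter-∁ P? [] = refl
length-filter-∁ P? (y ∷ ys) with does (P? y)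
... | true  = cong suc (length-filter-∁ P? ys)
... | false = trans (cong suc (length-filter-∁ P? ys)) (sym (+-suc _ _))

length-≤1 : ∀ {A : Set} {xs : List A} → Unique xs → (∀ {y z} → y ∈ xs → z ∈ xs → y ≡ z) → length xs ≤ 1
length-≤1 []               same = z≤n
length-≤1 (_ ∷ [])         same = s≤s z≤n
length-≤1 ((y≢z ∷ _) ∷ _ ∷ _) same = contradiction (same (here refl) (there (here refl))) y≢z

-- The list ws is an antichain in {0 < … < h} × 2ᴸ.  The poset {0 < … < h} × {false < true} is a
-- disjoint union of the chains (0,false) < … < (h,false) < (h,true) and
-- (0,true) < … < (h−1,true), so one coordinate of L can be absorbed into the level.
antichain-length : ∀ {V W : Set} (member : V → W → Bool) (L : List V) (h : ℕ) (level : W → ℕ) {ws : List W} →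
  Unique ws → (∀ {w} → w ∈ ws → level w ≤ h) →
  (∀ {u w} → u ∈ ws → w ∈ ws → level u ≤ level w →
     (∀ {v} → v ∈ L → member v u Bool.≤ member v w) → u ≡ w) →
  length ws ≤ walks (length L) h
antichain-length member [] h level uniq bounded antichain = length-≤1 uniq same
  where
  same : ∀ {u w} → u ∈ _ → w ∈ _ → u ≡ w
  same {u} {w} u∈ w∈ with ≤-total (level u) (level w)
  ... | inj₁ u≤w = antichain u∈ w∈ u≤w λ ()
  ... | inj₂ w≤u = sym (antichain w∈ u∈ w≤u λ ())
antichain-length {V} {W} member (l ∷ L) h level {ws} uniq bounded antichain = split h refl
  where
  Low : W → Set
  Low w = member l w ≡ true × level w < h

  Low? : Decidable Low
  Low? w = (member l w Bool.≟ true) ×-dec (level w <? h)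

  -- In `high`, an element containing l has level h and ends the first chain, so its new level is h
  -- + 1.
  level′ : W → ℕ
  level′ w with member l w
  ... | true  = suc h
  ... | false = level w

  level′≤1+h : ∀ {w} → w ∈ ws → level′ w ≤ suc h
  level′≤1+h {w} w∈ with member l w
  ... | true  = ≤-refl
  ... | false = m≤n⇒m≤1+n (bounded w∈)

  low high : List W
  low  = filter Low? ws
  high = filter (∁? Low?) ws

  cons : ∀ {u w} → member l u Bool.≤ member l w → (∀ {v} → v ∈ L → member v u Bool.≤ member v w) →
         ∀ {v} → v ∈ l ∷ L → member v u Bool.≤ member v w
  cons p q (here refl) = p
  cons p q (there v∈)  = q v∈

  high-bound : length high ≤ walks (length L) (suc h)
  high-bound = antichain-length member L (suc h) level′ (Unique.filter⁺ (∁? Low?) uniq)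
    (λ w∈ → level′≤1+h (proj₁ (∈-filter⁻ (∁? Low?) w∈)))
    (λ u∈ w∈ u≤w sub → compare (high⁻ u∈) (high⁻ w∈) u≤w sub)
    where
    top : ∀ {w} → w ∈ ws → ¬ Low w → member l w ≡ true → level w ≡ h
    top w∈ ¬low t with m≤n⇒m<n∨m≡n (bounded w∈)
    ... | inj₁ lt = contradiction (t , lt) ¬low
    ... | inj₂ eq = eq
    high⁻ : ∀ {w} → w ∈ high → w ∈ ws × (member l w ≡ true → level w ≡ h)
    high⁻ w∈ = let w∈ws , ¬low = ∈-filter⁻ (∁? Low?) w∈ in w∈ws , top w∈ws ¬low
    ≤-resp : ∀ {i j k l} → i ≡ k → j ≡ l → k Bool.≤ l → i Bool.≤ j
    ≤-resp refl refl p = p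
    compare : ∀ {u w} → u ∈ ws × (member l u ≡ true → level u ≡ h) → w ∈ ws × (member l w ≡ true → level w ≡ h) → level′ u ≤ level′ w →
      (∀ {v} → v ∈ L → member v u Bool.≤ member v w) → u ≡ w
    compare {u} {w} (u∈ , topᵘ) (w∈ , topʷ) u≤w sub
      with member l u in equ | member l w in eqw
    ... | false | false = antichain u∈ w∈ u≤w (cons (≤-resp equ eqw Bool.b≤b) sub)
    ... | false | true = antichain u∈ w∈ (≤-trans (bounded u∈) (≤-reflexive (sym (topʷ refl)))) (cons (≤-resp equ eqw Bool.f≤t) sub)
    ... | true | false = contradiction (≤-trans u≤w (bounded w∈)) 1+n≰n
    ... | true | true = antichain u∈ w∈ (≤-reflexive (trans (topᵘ refl) (sym (topʷ refl)))) (cons (≤-resp equ eqw Bool.b≤b) sub)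

  split : ∀ h′ → h′ ≡ h → length ws ≤ walks (suc (length L)) h′
  -- At h = 0 the second chain is empty, matching the single summand of `walks` at height 0.
  split zero refl = ≤-trans (≤-reflexive (length-filter-∁ Low? ws)) (+-mono-≤ low≤0 high-bound)
    where
    low≤0 : length low ≤ 0
    low≤0 with low in eq
    ... | []    = z≤n
    ... | w ∷ _ with () ← proj₂ (proj₂ (∈-filter⁻ Low? {xs = ws} (subst (w ∈_) (sym eq) (here refl))))
  split (suc h′) refl = ≤-trans (≤-reflexive (trans (length-filter-∁ Low? ws) (+-comm (length low) _)))
    (+-mono-≤ high-bound
      (antichain-length member L h′ level (Unique.filter⁺ Low? uniq)
        (λ w∈ → s≤s⁻¹ (proj₂ (proj₂ (∈-filter⁻ Low? {xs = ws} w∈))))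
        (λ u∈ w∈ u≤w sub → compare (∈-filter⁻ Low? u∈) (∈-filter⁻ Low? w∈) u≤w sub)))
    where
    compare : ∀ {u w} → u ∈ ws × Low u → w ∈ ws × Low w → level u ≤ level w →
      (∀ {v} → v ∈ L → member v u Bool.≤ member v w) → u ≡ w
    compare (u∈ , eqᵤ , _) (w∈ , eq , _) u≤w sub = antichain u∈ w∈ u≤w
      (cons (Boolₚ.≤-reflexive (trans eqᵤ (sym eq))) sub)

lookup-injective : ∀ {A : Set} {ys : List A} → Unique ys → ∀ {i j} → lookup ys i ≡ lookup ys j → i ≡ j
lookup-injective (_ ∷ _)  {zero}  {zero}  _  = refl
lookup-injective (y∉ ∷ _) {zero}  {suc j} eq = contradiction eq (All.lookup y∉ (∈-lookup j))
lookup-injective (y∉ ∷ _) {suc i} {zero}  eq = contradiction (sym eq) (All.lookup y∉ (∈-lookup i))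
lookup-injective (_ ∷ u)  {suc i} {suc j} eq = cong suc (lookup-injective u eq)

unique-length-≤ : ∀ {n} {ys : List (Fin n)} → Unique ys → length ys ≤ n
unique-length-≤ u = Finₚ.injective⇒≤ (lookup-injective u)

length-filter-map : ∀ {A B : Set} {P : B → Set} (P? : Decidable P) (f : A → B) ys →
  length (filter P? (map f ys)) ≡ length (filter (P? ∘ f) ys)
length-filter-map P? f [] = refl
length-filter-map P? f (y ∷ ys) with does (P? (f y))
... | true  = cong suc (length-filter-map P? f ys)
... | false = length-filter-map P? f ys

length-≤-fibres : ∀ {A B : Set} (_≟_ : DecidableEquality B) (f : A → B) (bound : B → ℕ) →
  (∀ k {ys} → Unique ys → (∀ {y} → y ∈ ys → f y ≡ k) → length ys ≤ bound k) →
  ∀ ks {ys} → Unique ys → (∀ {y} → y ∈ ys → f y ∈ ks) → length ys ≤ sum (map bound ks)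
length-≤-fibres _≟_ f bound fibre [] {[]} u covered = z≤n
length-≤-fibres _≟_ f bound fibre [] {y ∷ ys} u covered with () ← covered (here refl)
length-≤-fibres _≟_ f bound fibre (k ∷ ks) {ys} u covered = begin
  length ys                                     ≡⟨ length-filter-∁ P? ys ⟩
  length (filter P? ys) + length (filter (∁? P?) ys)
    ≤⟨ +-mono-≤ (fibre k (Unique.filter⁺ P? u) (λ y∈ → proj₂ (∈-filter⁻ P? {xs = ys} y∈)))
                (length-≤-fibres _≟_ f bound fibre ks (Unique.filter⁺ (∁? P?) u) rest) ⟩
  bound k + sum (map bound ks)                  ∎
  where
  open ≤-Reasoning
  P? : Decidable (λ y → f y ≡ k)
  P? y = f y ≟ k
  rest : ∀ {y} → y ∈ filter (∁? P?) ys → f y ∈ ks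
  rest y∈ with ∈-filter⁻ (∁? P?) {xs = ys} y∈
  ... | y∈ys , ≢k with covered y∈ys
  ...   | here ≡k   = contradiction ≡k ≢k
  ...   | there ∈ks = ∈ks

ballots-mono : ∀ {m n} → m ≤ n → ballots m ≤ ballots n
ballots-mono = go ∘ ≤⇒≤′
  where
  go : ∀ {m n} → m ≤′ n → ballots m ≤ ballots n
  go ≤′-refl                 = ≤-refl
  go {n = suc n} (≤′-step m≤n) = ≤-trans (go m≤n) (ballots-monoˢ n)

-- Types, classes and the finite check.

subsets : ∀ n → List (Vec Bool n)
subsets zero    = [] ∷ []
subsets (suc n) = map (true ∷_) (subsets n) ++ map (false ∷_) (subsets n)

∈-subsets : ∀ {n} (A : Vec Bool n) → A ∈ subsets n
∈-subsets []          = here refl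
∈-subsets (true ∷ A)  = ∈-++⁺ˡ (∈-map⁺ (true ∷_) (∈-subsets A))
∈-subsets (false ∷ A) = ∈-++⁺ʳ _ (∈-map⁺ (false ∷_) (∈-subsets A))

_≟ˢ_ : DecidableEquality Subset3
_≟ˢ_ = Vecₚ.≡-dec Bool._≟_

-- The flag records whether a single vertex of V₂ has this type.
Class : Set
Class = Subset3 × Bool

-- The two cases of comparability, A ⊆ T for β = true and T ⊆ A for β = false.
Below : Bool → Subset3 → Subset3 → Set
Below β T A = ∀ i → Vec.lookup A i ≡ β → Vec.lookup T i ≡ β

Comparable : Subset3 → Subset3 → Set
Comparable T A = Below true T A ⊎ Below false T A

-- Only vertices of type A can connect x i with a vertex of type T by a path of length two.
Critical : Subset3 → List Class → Subset3 → Set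
Critical T K A = ∃ λ i → All (λ c → proj₁ c ≢ A → Vec.lookup (proj₁ c) i ≡ Vec.lookup T i) K

Fixed : Subset3 → List Class → Class → Set
Fixed T K (A , s) = Comparable T A ⊎ (s ≡ true × Critical T K A)

-- Excludes vertices of type T in V₃: for such a w and the given i there would be no
-- path of length two opposite to the arc between x i and w.
Dead : Subset3 → List Class → Set
Dead T K = Any (λ c → proj₁ c ≡ T) K ⊎ (∃ λ i → All (λ c → Vec.lookup (proj₁ c) i ≡ Vec.lookup T i) K)

-- Here all of V₂, not only its representatives, has determined arcs to type T, which leaves room
-- for at most one vertex of that type in V₃.
Rigid : Subset3 → List Class → Set
Rigid T K = All (Comparable T ∘ proj₁) K

below? : ∀ β T A → Dec (Below β T A)
below? β T A = Finₚ.all? λ i → (Vec.lookup A i Bool.≟ β) →-dec (Vec.lookup T i Bool.≟ β)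

comparable? : ∀ T A → Dec (Comparable T A)
comparable? T A = below? true T A ⊎-dec below? false T A

critical? : ∀ T K A → Dec (Critical T K A)
critical? T K A = Finₚ.any? λ i → All.all? (λ c → ¬? (proj₁ c ≟ˢ A) →-dec (Vec.lookup (proj₁ c) i Bool.≟ Vec.lookup T i)) K

fixed? : ∀ T K c → Dec (Fixed T K c)
fixed? T K (A , s) = comparable? T A ⊎-dec ((s Bool.≟ true) ×-dec critical? T K A)

dead? : ∀ T K → Dec (Dead T K)
dead? T K = Any.any? (λ c → proj₁ c ≟ˢ T) K
  ⊎-dec Finₚ.any? λ i → All.all? (λ c → Vec.lookup (proj₁ c) i Bool.≟ Vec.lookup T i) K

rigid? : ∀ T K → Dec (Rigid T K)
rigid? T K = All.all? (comparable? T ∘ proj₁) K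

-- The number of vertices of type T in V₃ is at most weight n (level K T), where |V₂| = 3 + n.
level : List Class → Subset3 → ℕ
level K T = if does (dead? T K) then 0 else
  if does (rigid? T K) then 1 else 2 + (3 ∸ length (filter (fixed? T K) K))

-- Code k + 2 stands for Sperner's bound with k + n free vertices. The codes do not involve n, so
-- one finite check serves every p.
weight : ℕ → ℕ → ℕ
weight n 0             = 0
weight n 1             = 1
weight n (suc (suc k)) = ballots (k + n)

-- The flag s says that a type of V₂ has a single vertex; otherwise two vertices represent it.
copies : Subset3 → Bool → List Class
copies A true  = (A , true) ∷ []
copies A false = (A , false) ∷ (A , false) ∷ []

-- Up to order, the maximal values of levels K found by evaluation; the weights of the
-- last row sum to the bound of the theorem.
maximalLevels : List (List ℕ)
maximalLevels =
  (0 ∷ 0 ∷ 0 ∷ 1 ∷ 1 ∷ 3 ∷ 4 ∷ 4 ∷ []) ∷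
  (0 ∷ 0 ∷ 0 ∷ 1 ∷ 3 ∷ 3 ∷ 3 ∷ 3 ∷ []) ∷
  (0 ∷ 0 ∷ 0 ∷ 0 ∷ 1 ∷ 3 ∷ 3 ∷ 5 ∷ []) ∷
  (0 ∷ 0 ∷ 0 ∷ 0 ∷ 1 ∷ 2 ∷ 4 ∷ 5 ∷ []) ∷ []

levels : List Class → List ℕ
levels K = map (level K) (subsets 3)

-- Only the sum of the weights matters, so levels are compared after sorting, whichever types they
-- belong to.
DominatedLevels : List Class → Set
DominatedLevels K = Any (Pointwise _≤_ (sort (levels K))) maximalLevels

Distinct : Subset3 → Subset3 → Subset3 → Set
Distinct A₁ A₂ A₃ = A₁ ≢ A₂ × A₁ ≢ A₃ × A₂ ≢ A₃

classes : Subset3 → Bool → Subset3 → Bool → Subset3 → Bool → List Class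
classes A₁ s₁ A₂ s₂ A₃ s₃ = copies A₁ s₁ ++ copies A₂ s₂ ++ copies A₃ s₃

∀-subsets? : {n : ℕ} {P : Vec Bool n → Set} → Decidable P → Dec (∀ A → P A)
∀-subsets? P? = map′ (λ all A → All.lookup all (∈-subsets A)) (λ all → All.tabulate (λ {A} _ → all A)) (All.all? P? (subsets _))

∀-Bool? : {P : Bool → Set} → Decidable P → Dec (∀ s → P s)
∀-Bool? P? = map′ (λ { (t , f) true → t ; (t , f) false → f }) (λ all → all true , all false) (P? true ×-dec P? false)

levels-dominated? : Dec (∀ A₁ A₂ A₃ → Distinct A₁ A₂ A₃ → ∀ s₁ s₂ s₃ → DominatedLevels (classes A₁ s₁ A₂ s₂ A₃ s₃))
levels-dominated? = ∀-subsets? λ A₁ → ∀-subsets? λ A₂ → ∀-subsets? λ A₃ →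
  (¬? (A₁ ≟ˢ A₂) ×-dec ¬? (A₁ ≟ˢ A₃) ×-dec ¬? (A₂ ≟ˢ A₃)) →-dec
  ∀-Bool? λ s₁ → ∀-Bool? λ s₂ → ∀-Bool? λ s₃ →
  Any.any? (Pointwise.decidable _≤?_ _) maximalLevels

levels-dominated : ∀ A₁ A₂ A₃ → Distinct A₁ A₂ A₃ → ∀ s₁ s₂ s₃ → DominatedLevels (classes A₁ s₁ A₂ s₂ A₃ s₃)
levels-dominated = toWitness {a? = levels-dominated?} _

-- Inequalities between sums of weights.

weight-mono : ∀ n {k l} → k ≤ l → weight n k ≤ weight n l
weight-mono n {zero}        {l}           _   = z≤n
weight-mono n {suc zero}    {suc zero}    _   = ≤-refl
weight-mono n {suc zero}    {suc (suc l)} _   = 1≤ballots (l + n)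
weight-mono n {suc (suc k)} {suc (suc l)} (s≤s (s≤s k≤l)) = ballots-mono (+-monoˡ-≤ n k≤l)

target : ℕ → ℕ
target n = 1 + ballots n + ballots (2 + n) + ballots (3 + n)

-- Each sum is regrouped so that the inequalities between the ballot numbers apply summand by summand.
maximalLevels-bound : ∀ n → All (λ g → sum (map (weight n) g) ≤ target n) maximalLevels
maximalLevels-bound n =
  ≤-trans (≤-reflexive (regroup₁ e₁ e₂))
    (+-mono-≤ (+-monoˡ-≤ e₂ (+-monoʳ-≤ 1 (1≤ballots n))) (ballots-superadditive (1 + n))) ∷
  ≤-trans (≤-reflexive (regroup₂ e₁))
    (+-mono-≤ (≤-trans (+-monoʳ-≤ 1 (ballots-convex n)) (≤-reflexive (sym (+-assoc 1 e₀ e₂))))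
      (≤-trans (+-monoʳ-≤ e₁ (ballots-monoˢ (1 + n))) (ballots-superadditive (1 + n)))) ∷
  ≤-trans (≤-reflexive (regroup₃ e₁ e₃)) (+-monoˡ-≤ e₃ (+-monoʳ-≤ 1 (ballots-convex n))) ∷
  ≤-reflexive (regroup₄ e₀ e₂ e₃) ∷ []
  where
  e₀ e₁ e₂ e₃ : ℕ
  e₀ = ballots n
  e₁ = ballots (1 + n)
  e₂ = ballots (2 + n)
  e₃ = ballots (3 + n)
  regroup₁ : ∀ k l → 1 + (1 + (k + (l + (l + 0)))) ≡ (1 + 1 + l) + (k + l)
  regroup₁ = solve-∀
  regroup₂ : ∀ k → 1 + (k + (k + (k + (k + 0)))) ≡ (1 + (k + k)) + (k + k)
  regroup₂ = solve-∀
  regroup₃ : ∀ k l → 1 + (k + (k + (l + 0))) ≡ (1 + (k + k)) + l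
  regroup₃ = solve-∀
  regroup₄ : ∀ k l m → 1 + (k + (l + (m + 0))) ≡ 1 + k + l + m
  regroup₄ = solve-∀

sum-pointwise-≤ : ∀ n {ks ls} → Pointwise _≤_ ks ls → sum (map (weight n) ks) ≤ sum (map (weight n) ls)
sum-pointwise-≤ n []         = z≤n
sum-pointwise-≤ n (k≤l ∷ ps) = +-mono-≤ (weight-mono n k≤l) (sum-pointwise-≤ n ps)

levels-bound : ∀ n {K} → DominatedLevels K → sum (map (weight n ∘ level K) (subsets 3)) ≤ target n
levels-bound n {K} dominated = begin
  sum (map (weight n ∘ level K) (subsets 3))   ≡⟨ cong sum (map-∘ {g = weight n} {f = level K} (subsets 3)) ⟩
  sum (map (weight n) (levels K))              ≡⟨ sum-↭ (Permutation.map⁺ (weight n) (↭-sym (sort-↭ (levels K)))) ⟩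
  sum (map (weight n) (sort (levels K)))       ≤⟨ go dominated (maximalLevels-bound n) ⟩
  target n                                     ∎
  where
  open ≤-Reasoning
  go : ∀ {gs} → Any (Pointwise _≤_ (sort (levels K))) gs → All (λ g → sum (map (weight n) g) ≤ target n) gs →
       sum (map (weight n) (sort (levels K))) ≤ target n
  go (here ≤g)  (g≤ ∷ _)  = ≤-trans (sum-pointwise-≤ n ≤g) g≤
  go (there ≤g) (_ ∷ gs≤) = go ≤g gs≤

does-sound : {P : Set} (P? : Dec P) → does P? ≡ true → P
does-sound (yes p) _ = p

length-removed : ∀ {p} {R : List (Fin p)} → Unique R →
  ∃ λ L → (∀ v → v ∈ R ⊎ v ∈ L) × length L ≤ p ∸ length R
length-removed {p} {R} uniq = L , split , bound
  where
  open import Data.List.Membership.DecPropositional (Finₚ._≟_ {p}) using (_∈?_)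
  L : List (Fin p)
  L = filter (∁? (_∈? R)) (allFin p)
  split : ∀ v → v ∈ R ⊎ v ∈ L
  split v with v ∈? R
  ... | yes v∈R = inj₁ v∈R
  ... | no  v∉R = inj₂ (∈-filter⁺ (∁? (_∈? R)) (∈-allFin v) v∉R)
  bound : length L ≤ p ∸ length R
  bound = m+n≤o⇒m≤o∸n (length L) (≤-trans (≤-reflexive (sym (length-++ L)))
    (unique-length-≤ (Unique.++⁺ (Unique.filter⁺ (∁? (_∈? R)) (Unique.allFin⁺ p)) uniq
      λ { (∈L , ∈R) → proj₂ (∈-filter⁻ (∁? (_∈? R)) {xs = allFin p} ∈L) ∈R })))

-- Consequences of diameter two.

module _ {p q : ℕ} (D : Orientation p q) (dist : ∀ u v → Dist≤2 D u v) where
  open Orientation D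

  T⇒≡ : ∀ {s} → T s → s ≡ true
  T⇒≡ {true} _ = refl

  T-not⇒≡ : ∀ {s} → T (not s) → s ≡ false
  T-not⇒≡ {false} _ = refl

  -- The midpoint of a path of length two opposite to the arc between v and w is in V₁.
  return-path : ∀ v w → ∃ λ i → o12 i v ≡ o23 v w × o13 i w ≡ not (o23 v w)
  return-path v w with o23 v w in eq
  ... | true with dist (b w) (a v)
  ...   | inj₂ (inj₁ arc) with () ← trans (sym eq) (T-not⇒≡ arc)
  ...   | inj₂ (inj₂ (x i , w→i , i→v)) = i , T⇒≡ i→v , T-not⇒≡ w→i
  return-path v w | false with dist (a v) (b w)
  ...   | inj₂ (inj₁ arc) with () ← trans (sym eq) (T⇒≡ arc)
  ...   | inj₂ (inj₂ (x i , v→i , i→w)) = i , T-not⇒≡ v→i , T⇒≡ i→w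

  -- The midpoint of a path of length two opposite to the arc between x i and w lies in V₂, the only
  -- part containing neither end.
  return-path-x : ∀ i w → ∃ λ v → o12 i v ≡ o23 v w × o12 i v ≡ not (o13 i w)
  return-path-x i w with o13 i w in eq
  ... | true with dist (b w) (x i)
  ...   | inj₂ (inj₁ arc) with () ← trans (sym eq) (T-not⇒≡ arc)
  ...   | inj₂ (inj₂ (a v , w→v , v→i)) = v , trans (T-not⇒≡ v→i) (sym (T-not⇒≡ w→v)) , T-not⇒≡ v→i
  return-path-x i w | false with dist (x i) (b w)
  ...   | inj₂ (inj₁ arc) with () ← trans (sym eq) (T⇒≡ arc)
  ...   | inj₂ (inj₂ (a v , i→v , v→w)) = v , trans (T⇒≡ i→v) (sym (T⇒≡ v→w)) , T⇒≡ i→v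

  τ : Fin p → Subset3
  τ v = Vec.tabulate λ i → o12 i v

  σ : Fin q → Subset3
  σ w = Vec.tabulate λ i → o13 i w

  τ-lookup : ∀ v i → Vec.lookup (τ v) i ≡ o12 i v
  τ-lookup v i = Vecₚ.lookup∘tabulate (λ i → o12 i v) i

  σ-lookup : ∀ {w S} → σ w ≡ S → ∀ i → Vec.lookup S i ≡ o13 i w
  σ-lookup {w} refl i = Vecₚ.lookup∘tabulate (λ i → o13 i w) i

  -- A path u → x i → w would put i into the type of w but not into that of u, so the midpoint from
  -- u to w lies in V₂.
  separated : ∀ {u w} → u ≢ w → σ u ≡ σ w → ∃ λ v → o23 v u ≡ false × o23 v w ≡ true
  separated {u} {w} u≢w same with dist (b u) (b w)
  ... | inj₁ refl = contradiction refl u≢w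
  ... | inj₂ (inj₂ (a v , u→v , v→w)) = v , T-not⇒≡ u→v , T⇒≡ v→w
  ... | inj₂ (inj₂ (x i , u→i , i→w)) with
    () ← trans (sym (T-not⇒≡ u→i)) (trans (sym (σ-lookup {u} refl i)) (trans (σ-lookup (sym same) i) (T⇒≡ i→w)))

  Constant : Subset3 → Fin p → Set
  Constant S v = ∃ λ β → ∀ {w} → σ w ≡ S → o23 v w ≡ β

  -- If the arc had value β, the x i on its return path would have value β at v and `not β` at w,
  -- against `below`.
  below-constant : ∀ {β S v w} → Below β S (τ v) → σ w ≡ S → o23 v w ≡ not β
  below-constant {β} {S} {v} {w} below eq with return-path v w
  ... | i , τ≡ , σ≡ = Boolₚ.¬-not λ o≡β → Boolₚ.not-¬ {o23 v w} refl
    (trans o≡β (trans (sym (below i (trans (τ-lookup v i) (trans τ≡ o≡β)))) (trans (σ-lookup eq i) σ≡)))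

  comparable-constant : ∀ {S v} → Comparable S (τ v) → Constant S v
  comparable-constant (inj₁ below) = false , below-constant below
  comparable-constant (inj₂ below) = true , below-constant below

  Singleton : Fin p → Set
  Singleton v = ∀ u → τ u ≡ τ v → u ≡ v

  singleton? : ∀ v → Dec (Singleton v)
  singleton? v = Finₚ.all? λ u → (τ u ≟ˢ τ v) →-dec (u Finₚ.≟ v)

  class : Fin p → Class
  class v = τ v , does (singleton? v)

  -- Each fixed representative lowers the exponent in Sperner's bound by one. A shared type gets
  -- exactly two, which keeps the set of configurations finite.
  representatives : ∀ v → ∃ λ us → Unique us × (v ∈ us) × (∀ {u} → u ∈ us → τ u ≡ τ v) ×
    ∃ λ s → map class us ≡ copies (τ v) s
  representatives v with singleton? v
  ... | yes single = v ∷ [] , [] ∷ [] , here refl , (λ { (here refl) → refl }) , true ,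
    cong (λ s → (τ v , s) ∷ []) (dec-true (singleton? v) single)
  ... | no ¬single with Finₚ.¬∀⟶∃¬ p _ (λ u → (τ u ≟ˢ τ v) →-dec (u Finₚ.≟ v)) ¬single
  ...   | u , ¬imp with τ u ≟ˢ τ v
  ...     | no  τ≢ = contradiction (λ τ≡ → contradiction τ≡ τ≢) ¬imp
  ...     | yes τ≡ = v ∷ u ∷ [] , ((λ v≡u → ¬imp λ _ → sym v≡u) ∷ []) ∷ [] ∷ [] , here refl ,
    (λ { (here refl) → refl ; (there (here refl)) → τ≡ }) , false ,
    cong₂ (λ c d → c ∷ d ∷ []) (cong (τ v ,_) (dec-false (singleton? v) ¬single))
      (cong₂ _,_ τ≡ (dec-false (singleton? u) λ single → ¬imp λ _ → sym (single v (sym τ≡))))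

  -- Bounding the vertices of V₃ of each type.

  module _ (M : List (Fin p)) (unique : Unique M) (cover : ∀ v → ∃ λ u → u ∈ M × τ u ≡ τ v) where

    K : List Class
    K = map class M

    class∈K : ∀ v → ∃ λ s → (τ v , s) ∈ K
    class∈K v with cover v
    ... | u , u∈M , τ≡ = does (singleton? u) , subst (λ A → (A , does (singleton? u)) ∈ K) τ≡ (∈-map⁺ class u∈M)

    -- In the critical case the midpoint u opposite to the arc between x i and w disagrees with w at
    -- i, so it has the type of v and hence is v.
    fixed-constant : ∀ {S v} → Fixed S K (class v) → Constant S v
    fixed-constant (inj₁ comparable) = comparable-constant comparable
    fixed-constant {S} {v} (inj₂ (single , i , others)) = not (Vec.lookup S i) , λ {w} → value {w}
      where
      value : ∀ {w} → σ w ≡ S → o23 v w ≡ not (Vec.lookup S i)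
      value {w} eq with return-path-x i w
      ... | u , o12≡o23 , o12≡not with τ u ≟ˢ τ v
      ...   | yes τ≡ rewrite does-sound (singleton? v) single u τ≡ =
        trans (sym o12≡o23) (trans o12≡not (cong not (sym (σ-lookup eq i))))
      ...   | no  τ≢ = contradiction
        (trans (sym (τ-lookup u i)) (trans (All.lookup others (proj₂ (class∈K u)) τ≢) (σ-lookup eq i)))
        (λ o12≡o13 → Boolₚ.not-¬ {o13 i w} refl (trans (sym o12≡o13) o12≡not))

    -- Equal types leave no x i for a return path between v and w; agreement of V₂ with S at i
    -- leaves no midpoint between x i and w.
    dead-empty : ∀ {S} → Dead S K → ∀ w → σ w ≢ S
    dead-empty (inj₁ S∈K) w refl with Any.satisfied (Anyₚ.map⁻ S∈K)
    ... | v , τ≡ with return-path v w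
    ...   | i , τ-eq , σ-eq = Boolₚ.not-¬ {o23 v w} refl
      (trans (sym τ-eq) (trans (sym (τ-lookup v i)) (trans (σ-lookup (sym τ≡) i) σ-eq)))
    dead-empty (inj₂ (i , agree)) w refl with return-path-x i w
    ... | v , _ , o12≡not = Boolₚ.not-¬ {o13 i w} refl
      (trans (sym (σ-lookup {w} refl i)) (trans (sym (All.lookup agree (proj₂ (class∈K v)))) (trans (τ-lookup v i) o12≡not)))

    -- A vertex of V₂ separating two vertices of type S is not constant, so it lies in L. Thus the
    -- in-neighbourhoods within L form an antichain, and height 0 of `antichain-length` is Sperner's
    -- theorem.
    free-bound : ∀ S (L : List (Fin p)) → (∀ v → Constant S v ⊎ v ∈ L) →
      ∀ {ws} → Unique ws → (∀ {w} → w ∈ ws → σ w ≡ S) → length ws ≤ ballots (length L)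
    free-bound S L constant {ws} uniq typed =
      antichain-length o23 L 0 (λ _ → 0) uniq (λ _ → z≤n) antichain
      where
      antichain : ∀ {u w} → u ∈ ws → w ∈ ws → 0 ≤ 0 → (∀ {v} → v ∈ L → o23 v u Bool.≤ o23 v w) → u ≡ w
      antichain {u} {w} u∈ w∈ _ sub with u Finₚ.≟ w
      ... | yes u≡w = u≡w
      ... | no  u≢w with separated {w} {u} (u≢w ∘ sym) (trans (typed w∈) (sym (typed u∈)))
      ...   | v , w-false , u-true with constant v
      ...     | inj₁ (β , const) with () ← trans (sym w-false) (trans (const (typed w∈)) (trans (sym (const (typed u∈))) u-true))
      ...     | inj₂ v∈L with () ← subst (Bool._≤ false) u-true (subst (o23 v u Bool.≤_) w-false (sub v∈L))

    fibre-bound : ∀ n → p ≡ 3 + n → ∀ S {ws} → Unique ws → (∀ {w} → w ∈ ws → σ w ≡ S) →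
      length ws ≤ weight n (level K S)
    fibre-bound n p≡3+n S {ws} uniq typed = cases (dead? S K) (rigid? S K)
      where
      R : List (Fin p)
      R = filter (fixed? S K ∘ class) M

      r : ℕ
      r = length (filter (fixed? S K) K)

      none : ∀ {us} → Dead S K → (∀ {w} → w ∈ us → σ w ≡ S) → length us ≤ 0
      none {[]}    dead _     = z≤n
      none {w ∷ _} dead typed = contradiction (typed (here refl)) (dead-empty dead w)

      -- More than three representatives may be fixed; the level credits at most three, which only
      -- weakens the bound.
      ∸-shift : ∀ k r → k + n ∸ r ≤ (k ∸ r) + n
      ∸-shift k       zero    = ≤-refl
      ∸-shift zero    (suc r) = m∸n≤m n (suc r)
      ∸-shift (suc k) (suc r) = ∸-shift k r

      some : length ws ≤ ballots ((3 ∸ r) + n)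
      some = ≤-trans (free-bound S L constant uniq typed) (ballots-mono (begin
        length L        ≤⟨ proj₂ (proj₂ removed) ⟩
        p ∸ length R    ≡⟨ cong₂ _∸_ p≡3+n (sym (length-filter-map (fixed? S K) class M)) ⟩
        3 + n ∸ r       ≤⟨ ∸-shift 3 r ⟩
        (3 ∸ r) + n     ∎))
        where
        open ≤-Reasoning
        removed : ∃ λ L → (∀ v → v ∈ R ⊎ v ∈ L) × length L ≤ p ∸ length R
        removed = length-removed (Unique.filter⁺ (fixed? S K ∘ class) unique)
        L : List (Fin p)
        L = proj₁ removed
        fixed : ∀ {v} → v ∈ R → Constant S v
        fixed v∈R = fixed-constant (proj₂ (∈-filter⁻ (fixed? S K ∘ class) {xs = M} v∈R))
        constant : ∀ v → Constant S v ⊎ v ∈ L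
        constant v = map₁ fixed (proj₁ (proj₂ removed) v)

      -- With the decisions as arguments, matching on them reduces the conditionals of `level`.
      cases : (d : Dec (Dead S K)) (g : Dec (Rigid S K)) →
        length ws ≤ weight n (if does d then 0 else if does g then 1 else 2 + (3 ∸ r))
      cases (yes dead) _           = none dead typed
      cases (no _)     (yes rigid) =
        -- No vertex is free, and `ballots 0` is 1.
        free-bound S [] (λ v → inj₁ (comparable-constant (All.lookup rigid (proj₂ (class∈K v))))) uniq typed
      cases (no _)     (no _)      = some

    size-bound : ∀ n → p ≡ 3 + n → DominatedLevels K → q ≤ target n
    size-bound n p≡ dominated = begin
      q                                           ≡⟨ sym (length-tabulate id) ⟩
      length (allFin q)                           ≤⟨ length-≤-fibres _≟ˢ_ σ (weight n ∘ level K) (fibre-bound n p≡)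
                                                      (subsets 3) (Unique.allFin⁺ q) (λ {w} _ → ∈-subsets (σ w)) ⟩
      sum (map (weight n ∘ level K) (subsets 3))  ≤⟨ levels-bound n {K} dominated ⟩
      target n                                    ∎
      where open ≤-Reasoning

  -- Assembly from three types in V₂.

  three-types : ∀ n → p ≡ 3 + n → ∀ v₁ v₂ v₃ → Distinct (τ v₁) (τ v₂) (τ v₃) →
    (∀ v → τ v ≡ τ v₁ ⊎ τ v ≡ τ v₂ ⊎ τ v ≡ τ v₃) → q ≤ target n
  three-types n p≡3+n v₁ v₂ v₃ distinct@(τ₁≢τ₂ , τ₁≢τ₃ , τ₂≢τ₃) only
    with representatives v₁ | representatives v₂ | representatives v₃
  ... | us₁ , unique₁ , v₁∈ , τ₁ , s₁ , eq₁ | us₂ , unique₂ , v₂∈ , τ₂ , s₂ , eq₂ | us₃ , unique₃ , v₃∈ , τ₃ , s₃ , eq₃ =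
    size-bound M unique cover n p≡3+n
      (subst DominatedLevels (sym K≡) (levels-dominated (τ v₁) (τ v₂) (τ v₃) distinct s₁ s₂ s₃))
    where
    M : List (Fin p)
    M = us₁ ++ us₂ ++ us₃

    disjoint : ∀ {A B us us′} → A ≢ B → (∀ {u} → u ∈ us → τ u ≡ A) → (∀ {u} → u ∈ us′ → τ u ≡ B) → Disjoint us us′
    disjoint A≢B inA inB (u∈ , u∈′) = A≢B (trans (sym (inA u∈)) (inB u∈′))

    unique : Unique M
    unique = Unique.++⁺ unique₁ (Unique.++⁺ unique₂ unique₃ (disjoint τ₂≢τ₃ τ₂ τ₃)) λ { (u∈ , u∈′) →
      [ (λ u∈₂ → disjoint τ₁≢τ₂ τ₁ τ₂ (u∈ , u∈₂)) , (λ u∈₃ → disjoint τ₁≢τ₃ τ₁ τ₃ (u∈ , u∈₃)) ]′ (∈-++⁻ us₂ u∈′) }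

    cover : ∀ v → ∃ λ u → u ∈ M × τ u ≡ τ v
    cover v with only v
    ... | inj₁ τ≡        = v₁ , ∈-++⁺ˡ v₁∈ , sym τ≡
    ... | inj₂ (inj₁ τ≡) = v₂ , ∈-++⁺ʳ us₁ (∈-++⁺ˡ v₂∈) , sym τ≡
    ... | inj₂ (inj₂ τ≡) = v₃ , ∈-++⁺ʳ us₁ (∈-++⁺ʳ us₂ v₃∈) , sym τ≡

    K≡ : map class M ≡ classes (τ v₁) s₁ (τ v₂) s₂ (τ v₃) s₃
    K≡ = trans (map-++ class us₁ (us₂ ++ us₃)) (cong₂ _++_ eq₁ (trans (map-++ class us₂ us₃) (cong₂ _++_ eq₂ eq₃)))

  InN-τ : ∀ v → InN D (τ v) (a v)
  InN-τ v i rewrite τ-lookup v i with o12 i v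
  ... | true  = (λ _ → _) , λ ()
  ... | false = (λ ()) , λ _ → _

  InN⇒τ : ∀ {A v} → InN D A (a v) → A ≡ τ v
  InN⇒τ {A} {v} v∈ = trans (sym (Vecₚ.tabulate∘lookup A)) (Vecₚ.tabulate-cong λ i → agree i (v∈ i))
    where
    agree : ∀ i → (Vec.lookup A i ≡ true → T (o12 i v)) × (Vec.lookup A i ≡ false → T (not (o12 i v))) →
      Vec.lookup A i ≡ o12 i v
    agree i (out , into) with Vec.lookup A i
    ... | true  = sym (T⇒≡ (out refl))
    ... | false = sym (T-not⇒≡ (into refl))

theorem4p12 : (p q : ℕ) → 4 ≤ p → p ≤ q → (D : Orientation p q) →
    DiameterTwo D → ExactlyThreeNonEmpty D →
    q ≤ 1 + ((p ∸ 3) C ⌊ (p ∸ 3) /2⌋) + ((p ∸ 1) C ⌊ (p ∸ 1) /2⌋) + (p C ⌊ p /2⌋)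
theorem4p12 (suc (suc (suc n))) q (s≤s (s≤s (s≤s _))) p≤q D (dist , _)
  (A₁ , A₂ , A₃ , A≢ , ((v₁ , ∈₁) , (v₂ , ∈₂) , (v₃ , ∈₃)) , only)
  with refl ← InN⇒τ D dist {A₁} ∈₁ | refl ← InN⇒τ D dist {A₂} ∈₂ | refl ← InN⇒τ D dist {A₃} ∈₃ =
  subst (q ≤_) target≡ (three-types D dist n refl v₁ v₂ v₃ A≢ λ v → only _ (v , InN-τ D dist v))
  where
  target≡ : target n ≡ 1 + (n C ⌊ n /2⌋) + ((2 + n) C ⌊ (2 + n) /2⌋) + ((3 + n) C ⌊ (3 + n) /2⌋)
  target≡ = cong₂ _+_ (cong₂ _+_ (cong suc (ballots≡middle-binomial n)) (ballots≡middle-binomial (2 + n)))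
    (ballots≡middle-binomial (3 + n))
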